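{- $\mathcal{H}_{\mathrm{HP}}$ has $\mathrm{VC}$-dimension $1$, and for all primes $p\geq3$, $\mathcal{H}_{\mathrm{GS}_p}$ has $\mathrm{VC}$-dimension at most $3$.
   Context: A $3$-graph is a pair $H=(V,F)$ with $F\subseteq\binom V3$; $xyz=\{x,y,z\}$; $[n]=\{1,\dots,n\}$. A hereditary $3$-graph property is a class of finite $3$-graphs closed under isomorphism and induced sub-$3$-graphs. The $\mathrm{VC}$-dimension of a graph $(W,E)$ is the largest $k$ for which there are $a_1,\dots,a_k\in W$ and $b_S\in W$ for each $S\subseteq[k]$ with $a_ib_S\in E$ if and only if $i\in S$. For a $3$-graph $H=(V,F)$, $\mathrm{Graph}(H)$ is the bipartite graph with parts $V$ and $\binom V2$ and edges $\{ae:a\in V,e\in\binom V2,\{a\}\cup e\in F\}$; the $\mathrm{VC}$-dimension $\mathrm{VC}(H)$ of $H$ is the $\mathrm{VC}$-dimension of $\mathrm{Graph}(H)$. The $\mathrm{VC}$-dimension of a hereditary $3$-graph property $\mathcal{H}$ is $\max\{\mathrm{VC}(H):H\in\mathcal{H}\}$ (if finite). $\mathrm{HP}(k)$ is the $3$-partite $3$-graph with vertex set $\{a_i,b_i,c_i:i\in[k]\}$ and edge set $\{a_ub_vc_w:u+v+w\geq k+2\}$. $\mathcal{H}_{\mathrm{HP}}$ is the closure of $\{\mathrm{HP}(k):k\geq1\}$ under isomorphism and induced sub-$3$-graphs. $A(p,n)=\{x\in\mathbb{F}_p^n:\exists i\in[n]\text{ with }x_i=1\text{ and }x_j=0\text{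 for all }1\leq j<i\}$. $\mathrm{GS}_p(n)$ is the $3$-partite $3$-graph with vertex set $\{a_g,b_g,c_g:g\in\mathbb{F}_p^n\}$ and edge set $\{a_gb_{g'}c_{g''}:g+g'+g''\in A(p,n)\}$. $\mathcal{H}_{\mathrm{GS}_p}$ is the closure of $\{\mathrm{GS}_p(n):n\geq1\}$ under isomorphism and induced sub-$3$-graphs. -}

module Defs where

open import Data.Bool using (Bool; T)
open import Data.Bool.Properties using (T-irrelevant; T?)
open import Data.Empty using (⊥; ⊥-elim)
open import Data.Fin using (Fin; toℕ) renaming (_<_ to _<ᶠ_)
import Data.Fin.Properties as Finₚ
open import Data.Fin.Subset using (Subset; _∈_)
open import Data.List using (List; []; _∷_; cartesianProduct; cartesianProductWith; allFin)
open import Data.List.Membership.Propositional using () renaming (_∈_ to _∈ˡ_)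
open import Data.List.Membership.Propositional.Properties
  using (∈-cartesianProduct⁺; ∈-cartesianProductWith⁺; ∈-allFin)
open import Data.List.Relation.Unary.Any using (here; there)
open import Data.Nat using (ℕ; zero; suc; _+_; _≤_; NonZero)
import Data.Nat.Properties as ℕₚ
open import Data.Nat.DivMod using (_mod_)
open import Data.Product using (Σ-syntax; ∃-syntax; _×_; _,_; proj₁)
import Data.Product.Properties as ×ₚ
open import Data.Sum using (_⊎_; inj₁; inj₂)
open import Data.Vec using (Vec; []; _∷_; lookup; zipWith)
import Data.Vec.Properties as Vecₚ
open import Function using (_∘_; _⇔_; _↔_; Inverse)
open import Level using (0ℓ) renaming (suc to lsuc)
open import Relation.Binary using (DecidableEquality)
open import Relation.Binary.PropositionalEquality using (_≡_; _≢_; refl; cong)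
open import Relation.Nullary using (¬_; Dec; yes; no)
open import Relation.Nullary.Decidable using (_×-dec_; _→-dec_)
open import Relation.Unary using (Pred)

-- The edge set, a set of 3-element subsets of V, is encoded as a ternary
-- relation: F x y z says that x, y, z are distinct and {x,y,z} is an edge.
-- Invariance under the two transpositions gives invariance under S₃, and then
-- F-distinct forces all three vertices to be pairwise distinct.
record 3Graph : Set₁ where
  field
    V          : Set
    _≟_        : DecidableEquality V
    vertices   : List V
    enumerates : ∀ v → v ∈ˡ vertices
    F          : V → V → V → Set
    F?         : ∀ x y z → Dec (F x y z)
    F-swap₁₂   : ∀ {x y z} → F x y z → F y x z
    F-swap₂₃   : ∀ {x y z} → F x y z → F x z y
    F-distinct : ∀ {x y z} → F x y z → x ≢ y

record _≅_ (H K : 3Graph) : Set where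
  private
    module H = 3Graph H
    module K = 3Graph K
  field
    bijection : H.V ↔ K.V
  open Inverse bijection using (to)
  field
    edges : ∀ x y z → H.F x y z ⇔ K.F (to x) (to y) (to z)

module _ {A : Set} (U : A → Bool) where

  restrict : List A → List (Σ[ x ∈ A ] T (U x))
  restrict [] = []
  restrict (x ∷ xs) with T? (U x)
  ... | yes u = (x , u) ∷ restrict xs
  ... | no  _ = restrict xs

  ∈-restrict : ∀ {x xs} (u : T (U x)) → x ∈ˡ xs → (x , u) ∈ˡ restrict xs
  ∈-restrict {x} u (here refl) with T? (U x)
  ... | yes u′ = here (cong (x ,_) (T-irrelevant u u′))
  ... | no ¬u  = ⊥-elim (¬u u)
  ∈-restrict {xs = y ∷ _} u (there x∈xs) with T? (U y)
  ... | yes _ = there (∈-restrict u x∈xs)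
  ... | no  _ = ∈-restrict u x∈xs

induced : (H : 3Graph) → (3Graph.V H → Bool) → 3Graph
induced H U = record
  { V          = Σ[ x ∈ V ] T (U x)
  ; _≟_        = ×ₚ.≡-dec _≟_ (λ u u′ → yes (T-irrelevant u u′))
  ; vertices   = restrict U vertices
  ; enumerates = λ (x , u) → ∈-restrict U u (enumerates x)
  ; F          = λ (x , _) (y , _) (z , _) → F x y z
  ; F?         = λ (x , _) (y , _) (z , _) → F? x y z
  ; F-swap₁₂   = F-swap₁₂
  ; F-swap₂₃   = F-swap₂₃
  ; F-distinct = λ f x≡y → F-distinct f (cong proj₁ x≡y)
  }
  where open 3Graph H

record HereditaryProperty : Set₂ where
  field
    Member         : Pred 3Graph (lsuc 0ℓ)
    iso-closed     : ∀ {H K} → H ≅ K → Member H → Member K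
    induced-closed : ∀ {H} (U : 3Graph.V H → Bool) → Member H → Member (induced H U)

-- The closure of {G k : k ≥ 1}; the value G 0 plays no role.
data Closure (G : ℕ → 3Graph) : Pred 3Graph (lsuc 0ℓ) where
  base : ∀ {k} → 1 ≤ k → Closure G (G k)
  iso  : ∀ {H K} → H ≅ K → Closure G H → Closure G K
  ind  : ∀ {H} (U : 3Graph.V H → Bool) → Closure G H → Closure G (induced H U)

closure : (ℕ → 3Graph) → HereditaryProperty
closure G = record { Member = Closure G ; iso-closed = iso ; induced-closed = ind }

record Graph : Set₁ where
  field
    W        : Set
    E        : W → W → Set
    E-sym    : ∀ {x y} → E x y → E y x
    E-irrefl : ∀ {x} → ¬ E x x

IsMax : ∀ {ℓ} → Pred ℕ ℓ → ℕ → Set ℓ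
IsMax P d = P d × (∀ k → P k → k ≤ d)

Shatters : Graph → ℕ → Set
Shatters G k =
  Σ[ a ∈ (Fin k → W) ] Σ[ b ∈ (Subset k → W) ]
    (∀ i S → E (a i) (b S) ⇔ i ∈ S)
  where open Graph G

VCdim : Graph → ℕ → Set
VCdim G = IsMax (Shatters G)

-- An unordered pair {x,y} is given by an ordering of its two elements. So in
-- GraphOf each vertex e of the second part occurs as two twins with the same
-- neighbours, which does not affect VC-dimension.
Pair : Set → Set
Pair V = Σ[ (x , y) ∈ V × V ] x ≢ y

module _ (H : 3Graph) where
  open 3Graph H

  Incident : V ⊎ Pair V → V ⊎ Pair V → Set
  Incident (inj₁ a)             (inj₂ ((x , y) , _)) = F a x y
  Incident (inj₂ ((x , y) , _)) (inj₁ a)             = F a x y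
  Incident (inj₁ _)             (inj₁ _)             = ⊥
  Incident (inj₂ _)             (inj₂ _)             = ⊥

  GraphOf : Graph
  GraphOf = record
    { W        = V ⊎ Pair V
    ; E        = Incident
    ; E-sym    = λ {e} {f} → incident-sym e f
    ; E-irrefl = λ {e} → incident-irrefl e
    }
    where
    incident-sym : ∀ e f → Incident e f → Incident f e
    incident-sym (inj₁ _) (inj₂ _) i = i
    incident-sym (inj₂ _) (inj₁ _) i = i

    incident-irrefl : ∀ e → ¬ Incident e e
    incident-irrefl (inj₁ _) ()
    incident-irrefl (inj₂ _) ()

VC : 3Graph → ℕ → Set
VC H = VCdim (GraphOf H)

VCproperty : HereditaryProperty → ℕ → Set₁
VCproperty 𝓗 = IsMax (λ d → ∃[ H ] (HereditaryProperty.Member 𝓗 H × VC H d))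

data Part : Set where
  a b c : Part

_≟ᴾ_ : DecidableEquality Part
a ≟ᴾ a = yes refl
a ≟ᴾ b = no λ ()
a ≟ᴾ c = no λ ()
b ≟ᴾ a = no λ ()
b ≟ᴾ b = yes refl
b ≟ᴾ c = no λ ()
c ≟ᴾ a = no λ ()
c ≟ᴾ b = no λ ()
c ≟ᴾ c = yes refl

parts : List Part
parts = a ∷ b ∷ c ∷ []

∈-parts : ∀ s → s ∈ˡ parts
∈-parts a = here refl
∈-parts b = there (here refl)
∈-parts c = there (there (here refl))

-- The six orderings of an edge a_u b_v c_w.
data TripartiteEdge {I : Set} (R : I → I → I → Set) :
       Part × I → Part × I → Part × I → Set where
  abc : ∀ {u v w} → R u v w → TripartiteEdge R (a , u) (b , v) (c , w)
  acb : ∀ {u v w} → R u v w → TripartiteEdge R (a , u) (c , w) (b , v)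
  bac : ∀ {u v w} → R u v w → TripartiteEdge R (b , v) (a , u) (c , w)
  bca : ∀ {u v w} → R u v w → TripartiteEdge R (b , v) (c , w) (a , u)
  cab : ∀ {u v w} → R u v w → TripartiteEdge R (c , w) (a , u) (b , v)
  cba : ∀ {u v w} → R u v w → TripartiteEdge R (c , w) (b , v) (a , u)

module _ {I : Set} (_≟ᴵ_ : DecidableEquality I)
         (indices : List I) (∈-indices : ∀ i → i ∈ˡ indices)
         (R : I → I → I → Set) (R? : ∀ u v w → Dec (R u v w)) where

  tripartite : 3Graph
  tripartite = record
    { V          = Part × I
    ; _≟_        = ×ₚ.≡-dec _≟ᴾ_ _≟ᴵ_
    ; vertices   = cartesianProduct parts indices
    ; enumerates = λ (s , i) → ∈-cartesianProduct⁺ (∈-parts s) (∈-indices i)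
    ; F          = TripartiteEdge R
    ; F?         = edge?
    ; F-swap₁₂   = swap₁₂
    ; F-swap₂₃   = swap₂₃
    ; F-distinct = distinct
    }
    where
    by : ∀ {u v w x y z} →
         (R u v w → TripartiteEdge R x y z) → (TripartiteEdge R x y z → R u v w) →
         Dec (TripartiteEdge R x y z)
    by {u} {v} {w} f g with R? u v w
    ... | yes r = yes (f r)
    ... | no ¬r = no (¬r ∘ g)

    edge? : ∀ x y z → Dec (TripartiteEdge R x y z)
    edge? (a , _) (b , _) (c , _) = by abc λ { (abc r) → r }
    edge? (a , _) (c , _) (b , _) = by acb λ { (acb r) → r }
    edge? (b , _) (a , _) (c , _) = by bac λ { (bac r) → r }
    edge? (b , _) (c , _) (a , _) = by bca λ { (bca r) → r }
    edge? (c , _) (a , _) (b , _) = by cab λ { (cab r) → r }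
    edge? (c , _) (b , _) (a , _) = by cba λ { (cba r) → r }
    edge? (a , _) (a , _) _       = no λ ()
    edge? (b , _) (b , _) _       = no λ ()
    edge? (c , _) (c , _) _       = no λ ()
    edge? (a , _) (b , _) (a , _) = no λ ()
    edge? (a , _) (b , _) (b , _) = no λ ()
    edge? (a , _) (c , _) (a , _) = no λ ()
    edge? (a , _) (c , _) (c , _) = no λ ()
    edge? (b , _) (a , _) (a , _) = no λ ()
    edge? (b , _) (a , _) (b , _) = no λ ()
    edge? (b , _) (c , _) (b , _) = no λ ()
    edge? (b , _) (c , _) (c , _) = no λ ()
    edge? (c , _) (a , _) (a , _) = no λ ()
    edge? (c , _) (a , _) (c , _) = no λ ()
    edge? (c , _) (b , _) (b , _) = no λ ()
    edge? (c , _) (b , _) (c , _) = no λ ()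

    swap₁₂ : ∀ {x y z} → TripartiteEdge R x y z → TripartiteEdge R y x z
    swap₁₂ (abc r) = bac r
    swap₁₂ (acb r) = cab r
    swap₁₂ (bac r) = abc r
    swap₁₂ (bca r) = cba r
    swap₁₂ (cab r) = acb r
    swap₁₂ (cba r) = bca r

    swap₂₃ : ∀ {x y z} → TripartiteEdge R x y z → TripartiteEdge R x z y
    swap₂₃ (abc r) = acb r
    swap₂₃ (acb r) = abc r
    swap₂₃ (bac r) = bca r
    swap₂₃ (bca r) = bac r
    swap₂₃ (cab r) = cba r
    swap₂₃ (cba r) = cab r

    distinct : ∀ {x y z} → TripartiteEdge R x y z → x ≢ y
    distinct (abc _) ()
    distinct (acb _) ()
    distinct (bac _) ()
    distinct (bca _) ()
    distinct (cab _) ()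
    distinct (cba _) ()

-- Fin k stands for [k], with i : Fin k standing for the number ⟦ i ⟧.
⟦_⟧ : ∀ {k} → Fin k → ℕ
⟦ i ⟧ = suc (toℕ i)

HP : ℕ → 3Graph
HP k = tripartite Finₚ._≟_ (allFin k) ∈-allFin
  (λ u v w → k + 2 ≤ ⟦ u ⟧ + ⟦ v ⟧ + ⟦ w ⟧)
  (λ u v w → k + 2 ℕₚ.≤? ⟦ u ⟧ + ⟦ v ⟧ + ⟦ w ⟧)

𝓗HP : HereditaryProperty
𝓗HP = closure HP

-- Fin p stands for ℤ/p (for p prime, 𝔽_p), of which only the addition, 0 and 1
-- are needed.
𝔽^ : ℕ → ℕ → Set
𝔽^ p n = Vec (Fin p) n

_⊕_ : ∀ {p n} .⦃ _ : NonZero p ⦄ → 𝔽^ p n → 𝔽^ p n → 𝔽^ p n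
_⊕_ {p} = zipWith (λ x y → (toℕ x + toℕ y) mod p)

A : (p n : ℕ) → Pred (𝔽^ p n) 0ℓ
A p n x = ∃[ i ] (toℕ (lookup x i) ≡ 1 × (∀ j → j <ᶠ i → toℕ (lookup x j) ≡ 0))

A? : ∀ p n (x : 𝔽^ p n) → Dec (A p n x)
A? p n x = Finₚ.any? λ i →
  (toℕ (lookup x i) ℕₚ.≟ 1) ×-dec
  Finₚ.all? λ j → (j Finₚ.<? i) →-dec (toℕ (lookup x j) ℕₚ.≟ 0)

vectors : ∀ p n → List (𝔽^ p n)
vectors p zero    = [] ∷ []
vectors p (suc n) = cartesianProductWith _∷_ (allFin p) (vectors p n)

∈-vectors : ∀ {p n} (x : 𝔽^ p n) → x ∈ˡ vectors p n
∈-vectors []      = here refl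
∈-vectors (x ∷ xs) = ∈-cartesianProductWith⁺ _∷_ (∈-allFin x) (∈-vectors xs)

GS : (p : ℕ) .⦃ _ : NonZero p ⦄ → ℕ → 3Graph
GS p n = tripartite (Vecₚ.≡-dec Finₚ._≟_) (vectors p n) ∈-vectors
  (λ g g′ g″ → A p n ((g ⊕ g′) ⊕ g″))
  (λ g g′ g″ → A? p n ((g ⊕ g′) ⊕ g″))

𝓗GS : (p : ℕ) .⦃ _ : NonZero p ⦄ → HereditaryProperty
𝓗GS p = closure (GS p)

{-# OPTIONS --safe #-}

-- Incidence of a vertex and a pair in suitable parts depends only on the sum of
-- their indices, so a shattered configuration becomes one of sums xᵢ + y_S.
-- For HP, xᵢ + y ≥ k + 2 is monotone in xᵢ, so no two points can be separated in
-- both ways.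
--
-- For GS_p, put z = −y: then x + y ∈ A(p,n) iff, at the first coordinate where x
-- and z differ, x is one more than z, i.e. x leaves the path z in the p-ary tree
-- at the next child.  Consider the first coordinate of k ≥ 3 points all of whose
-- subsets of size 1 and 2 are cut out.  Two different values must differ by ±1,
-- and a value taken twice must be the only one.  So either the coordinate is
-- constant, and can be dropped, or it is injective with values pairwise
-- differing by ±1, which fails for k = 4 if p = 3 and for k = 3 if p ≥ 4.
-- These bounds are attained, so the VC-dimension is 3 for p = 3 and 2 for p ≥ 5.

module Submission where

open import Defs
open import Algebra.Bundles using (AbelianGroup; CommutativeSemigroup)
open import Algebra.Consequences.Propositional using (comm∧idˡ⇒id; comm∧invˡ⇒inv)
open import Algebra.Core using (Op₂)
import Algebra.Properties.CommutativeSemigroup as CommutativeSemigroupₚ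
import Algebra.Properties.Group as Groupₚ
open import Algebra.Structures using (IsAbelianGroup; IsCommutativeSemigroup)
open import Data.Bool.Properties using (T-irrelevant)
open import Data.Empty using (⊥; ⊥-elim)
open import Data.Fin using (Fin; zero; suc; toℕ; inject≤)
open import Data.Fin.Patterns using (0F; 1F; 2F)
import Data.Fin.Properties as Finₚ
open import Data.Fin.Subset using (Subset; _∈_; ⁅_⁆; _∪_; Nonempty; inside; outside)
open import Data.Fin.Subset.Properties
  using (_∈?_; ∈⊤; x∈⁅x⁆; x∈⁅y⁆⇔x≡y; ∪⇔⊎; x∈p∪q⁺; drop-there)
open import Data.List using (List)
open import Data.List.Membership.Propositional using () renaming (_∈_ to _∈ˡ_)
open import Data.Maybe using (Maybe; just; nothing)
open import Data.Nat using (ℕ; zero; suc; _+_; _∸_; _≤_; _%_; _≤′_; NonZero;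
  ≤′-reflexive; ≤′-step; z≤n; s≤s)
open import Data.Nat.DivMod
  using (_mod_; %-distribˡ-+; m<n⇒m%n≡m; n%n≡0; m%n<n; m*n%n≡0)
open import Data.Nat.Primality using (Prime)
import Data.Nat.Properties as ℕₚ
open import Data.Product using (∃-syntax; Σ-syntax; _×_; _,_; proj₁; proj₂; uncurry)
open import Data.Product.Function.NonDependent.Propositional using (_×-⇔_)
open import Data.Product.Properties using (Σ-≡,≡→≡)
open import Data.Sum using (_⊎_; inj₁; inj₂; [_,_]′; map₂; reduce)
open import Data.Sum.Function.Propositional using (_⊎-⇔_)
open import Data.Vec using (there; Vec; []; _∷_; head; tail; map)
import Data.Vec.Properties as Vecₚ
open import Function using (_∘_; _$_; _⇔_; mk⇔; Equivalence; Inverse; id)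
open import Function.Construct.Composition using (_⇔-∘_)
open import Function.Construct.Symmetry using (⇔-sym)
open import Function.Definitions using (Injective)
open import Level using (0ℓ)
open import Relation.Binary using (DecidableEquality)
open import Relation.Binary.PropositionalEquality
  using (_≡_; _≢_; refl; sym; trans; cong; cong₂; subst; module ≡-Reasoning)
open import Relation.Binary.PropositionalEquality.Algebra using (isMagma)
open import Relation.Nullary using (¬_; Dec; yes; no; contradiction)
open import Relation.Nullary.Decidable using (_×-dec_; _→-dec_; from-yes; map′)
open import Relation.Unary using (Pred; Decidable)

open Equivalence using (to; from)
open 3Graph using (V; F)

-- Transfer of shattering from a closure to its generators

Shatters-pred : ∀ G {k} → Shatters G (suc k) → Shatters G k
Shatters-pred G (x , y , sh) = x ∘ suc , y ∘ (outside ∷_) , λ i S →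
  mk⇔ drop-there there ⇔-∘ sh (suc i) (outside ∷ S)

Shatters-antitone : ∀ G {j k} → j ≤′ k → Shatters G k → Shatters G j
Shatters-antitone G (≤′-reflexive refl) = id
Shatters-antitone G (≤′-step j≤k)       = Shatters-antitone G j≤k ∘ Shatters-pred G

¬Shatters⇒≤ : ∀ G {d k} → ¬ Shatters G (suc d) → Shatters G k → k ≤ d
¬Shatters⇒≤ G ¬sh sh = ℕₚ.≮⇒≥ λ d<k → ¬sh (Shatters-antitone G (ℕₚ.≤⇒≤′ d<k) sh)

-- Injectivity of `f` keeps the two ends of a pair distinct, so pairs map to pairs.
Shatters-embed : ∀ {K H k} (f : V K → V H) → Injective _≡_ _≡_ f →
                 (∀ x y z → F K x y z ⇔ F H (f x) (f y) (f z)) →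
                 Shatters (GraphOf K) k → Shatters (GraphOf H) k
Shatters-embed {K} {H} f f-inj edges (x , y , sh) = g ∘ x , g ∘ y , λ i S →
  sh i S ⇔-∘ ⇔-sym (incident (x i) (y S))
  where
  g : V K ⊎ Pair (V K) → V H ⊎ Pair (V H)
  g (inj₁ u)               = inj₁ (f u)
  g (inj₂ ((v , w) , v≢w)) = inj₂ ((f v , f w) , v≢w ∘ f-inj)

  incident : ∀ d e → Incident K d e ⇔ Incident H (g d) (g e)
  incident (inj₁ _) (inj₂ _) = edges _ _ _
  incident (inj₂ _) (inj₁ _) = edges _ _ _
  incident (inj₁ _) (inj₁ _) = mk⇔ id id
  incident (inj₂ _) (inj₂ _) = mk⇔ id id

Shatters-Closure : ∀ {G H d} → Closure G H → Shatters (GraphOf H) d →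
                   ∃[ k ] Shatters (GraphOf (G k)) d
Shatters-Closure (base {k} _) sh = k , sh
Shatters-Closure (iso {H} {K} H≅K m) sh =
  Shatters-Closure m (Shatters-embed {K} {H} (Inverse.from bijection) from-injective edges⁻¹ sh)
  where
  open _≅_ H≅K
  open Inverse bijection using (strictlyInverseˡ) renaming (from to from′)

  from-injective : Injective _≡_ _≡_ from′
  from-injective {x} {y} eq =
    trans (sym (strictlyInverseˡ x)) (trans (cong (Inverse.to bijection) eq) (strictlyInverseˡ y))

  edges⁻¹ : ∀ x y z → F K x y z ⇔ F H (from′ x) (from′ y) (from′ z)
  edges⁻¹ x y z
    with e ← edges (from′ x) (from′ y) (from′ z)
    rewrite strictlyInverseˡ x | strictlyInverseˡ y | strictlyInverseˡ z = ⇔-sym e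
Shatters-Closure (ind {H} U m) sh =
  Shatters-Closure m
    (Shatters-embed {induced H U} {H} proj₁ (λ eq → Σ-≡,≡→≡ (eq , T-irrelevant _ _))
      (λ _ _ _ → mk⇔ id id) sh)

-- A configuration shattered in any member embeds into some `G k`, so the upper bound need only be
-- checked on the generators; `G n` attains it.
VCproperty-closure : ∀ G {d n} → (∀ k → ¬ Shatters (GraphOf (G k)) (suc d)) →
                     1 ≤ n → Shatters (GraphOf (G n)) d → VCproperty (closure G) d
VCproperty-closure G {d} {n} ¬sh 1≤n sh =
  (G n , base 1≤n , sh , λ _ → ¬Shatters⇒≤ (GraphOf (G n)) (¬sh n)) ,
  λ { k (H , H∈ , shH , _) → ¬Shatters⇒≤ (GraphOf H) (uncurry ¬sh ∘ Shatters-Closure H∈) shH }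

-- Tripartite 3-graphs whose edges depend on a sum over their vertices

-- A vertex is classified by its part, a pair by the part that vertices incident
-- to it must lie in (if any).
Kind : Set
Kind = Part ⊎ Maybe Part

third : Part → Part → Maybe Part
third a b = just c
third a c = just b
third b a = just c
third b c = just a
third c a = just b
third c b = just a
third a a = nothing
third b b = nothing
third c c = nothing

data Opposite : Kind → Kind → Set where
  vertex-pair : ∀ {s m} → m ≡ just s → Opposite (inj₁ s) (inj₂ m)
  pair-vertex : ∀ {s m} → m ≡ just s → Opposite (inj₂ m) (inj₁ s)

-- A vertex in part `s` and a pair kind `just s` determine each other, so `Opposite` is a partial
-- matching of kinds.
Opposite-difunctional : ∀ {d d′ e e′} → Opposite d e → Opposite d′ e →
                        Opposite d e′ → Opposite d′ e′
Opposite-difunctional (vertex-pair p) (vertex-pair q) (vertex-pair r) =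
  vertex-pair (trans r (trans (sym p) q))
Opposite-difunctional (pair-vertex p) (pair-vertex q) (pair-vertex r) with refl ← trans (sym p) r =
  pair-vertex q

module _ {I M : Set} {_∙_ : Op₂ M} (isCS : IsCommutativeSemigroup _≡_ _∙_)
         (value : I → M) (P : Pred M 0ℓ) where

  private
    R : I → I → I → Set
    R u v w = P ((value u ∙ value v) ∙ value w)

    CS : CommutativeSemigroup 0ℓ 0ℓ
    CS = record { isCommutativeSemigroup = isCS }

  open CommutativeSemigroup CS using (assoc; comm)
  open CommutativeSemigroupₚ CS

  edge⁻ : ∀ {s t q u v w} → TripartiteEdge R (s , u) (t , v) (q , w) →
          third t q ≡ just s × P (value u ∙ (value v ∙ value w))
  edge⁻ (abc r) = refl , subst P (assoc _ _ _) r
  edge⁻ (acb r) = refl , subst P (xy∙z≈x∙zy _ _ _) r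
  edge⁻ (bac r) = refl , subst P (xy∙z≈y∙xz _ _ _) r
  edge⁻ (bca r) = refl , subst P (xy∙z≈y∙zx _ _ _) r
  edge⁻ (cab r) = refl , subst P (xy∙z≈z∙xy _ _ _) r
  edge⁻ (cba r) = refl , subst P (xy∙z≈z∙yx _ _ _) r

  edge⁺ : ∀ {s u v w} t q → third t q ≡ just s → P (value u ∙ (value v ∙ value w)) →
          TripartiteEdge R (s , u) (t , v) (q , w)
  edge⁺ b c refl r = abc (subst P (sym (assoc _ _ _)) r)
  edge⁺ c b refl r = acb (subst P (sym (xy∙z≈x∙zy _ _ _)) r)
  edge⁺ a c refl r = bac (subst P (sym (xy∙z≈y∙xz _ _ _)) r)
  edge⁺ c a refl r = bca (subst P (sym (xy∙z≈y∙zx _ _ _)) r)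
  edge⁺ a b refl r = cab (subst P (sym (xy∙z≈z∙xy _ _ _)) r)
  edge⁺ b a refl r = cba (subst P (sym (xy∙z≈z∙yx _ _ _)) r)

  module _ (_≟ᴵ_ : DecidableEquality I)
           (indices : List I) (∈-indices : ∀ i → i ∈ˡ indices)
           (R? : ∀ u v w → Dec (R u v w)) where

    private
      H : 3Graph
      H = tripartite _≟ᴵ_ indices ∈-indices R R?

      kind : V H ⊎ Pair (V H) → Kind
      kind (inj₁ (s , _))                 = inj₁ s
      kind (inj₂ (((s , _) , t , _) , _)) = inj₂ (third s t)

      weight : V H ⊎ Pair (V H) → M
      weight (inj₁ (_ , u))                 = value u
      weight (inj₂ (((_ , v) , _ , w) , _)) = value v ∙ value w

      incident⁻ : ∀ d e → Incident H d e → Opposite (kind d) (kind e) × P (weight d ∙ weight e)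
      incident⁻ (inj₁ _) (inj₂ _) i with s , p ← edge⁻ i = vertex-pair s , p
      incident⁻ (inj₂ _) (inj₁ _) i with s , p ← edge⁻ i = pair-vertex s , subst P (comm _ _) p

      incident⁺ : ∀ d e → Opposite (kind d) (kind e) → P (weight d ∙ weight e) → Incident H d e
      incident⁺ (inj₁ _) (inj₂ _) (vertex-pair s) p = edge⁺ _ _ s p
      incident⁺ (inj₂ _) (inj₁ _) (pair-vertex s) p = edge⁺ _ _ s (subst P (comm _ _) p)

    -- S must be nonempty: b_∅ may be incident to nothing because of its part
    -- rather than its weight.
    Shatters⇒sums : ∀ {k} → Shatters (GraphOf H) k →
      Σ[ x ∈ (Fin k → M) ] Σ[ y ∈ (Subset k → M) ] (∀ i S → Nonempty S → P (x i ∙ y S) ⇔ i ∈ S)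
    Shatters⇒sums (x , y , sh) = weight ∘ x , weight ∘ y , λ i S (j , j∈S) → mk⇔
      (λ p → to (sh i S) (incident⁺ (x i) (y S)
        -- The full set links all points: `x i` and `x j` are both incident to `y ⊤`, and `x j` to
        -- `y S`. So the parts of `x i` and `y S` fit, and the weights alone decide incidence.
        (Opposite-difunctional (opposite (∈⊤ {x = j})) (opposite ∈⊤) (opposite j∈S)) p))
      (λ i∈S → proj₂ (incident⁻ (x i) (y S) (from (sh i S) i∈S)))
      where
      opposite : ∀ {i S} → i ∈ S → Opposite (kind (x i)) (kind (y S))
      opposite {i} {S} i∈S = proj₁ (incident⁻ (x i) (y S) (from (sh i S) i∈S))

-- Decidability of shattering for given vertices

allSubsets? : ∀ {k ℓ} {P : Pred (Subset k) ℓ} → Decidable P → Dec (∀ S → P S)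
allSubsets? {zero}  P? = map′ (λ { p [] → p }) (_$ []) (P? [])
allSubsets? {suc k} P? = map′
  (λ { (p , q) (inside ∷ S) → p S ; (p , q) (outside ∷ S) → q S })
  (λ p → p ∘ (inside ∷_) , p ∘ (outside ∷_))
  (allSubsets? (P? ∘ (inside ∷_)) ×-dec allSubsets? (P? ∘ (outside ∷_)))

module _ {H : 3Graph} where
  open 3Graph H using (F?)

  incident? : ∀ d e → Dec (Incident H d e)
  incident? (inj₁ u)             (inj₂ ((v , w) , _)) = F? u v w
  incident? (inj₂ ((v , w) , _)) (inj₁ u)             = F? u v w
  incident? (inj₁ _)             (inj₁ _)             = no λ ()
  incident? (inj₂ _)             (inj₂ _)             = no λ ()

  shattered? : ∀ {k} (x : Fin k → V H ⊎ Pair (V H)) (y : Subset k → V H ⊎ Pair (V H)) →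
               Dec (∀ i S → Incident H (x i) (y S) ⇔ i ∈ S)
  shattered? x y = Finₚ.all? λ i → allSubsets? λ S →
    map′ (uncurry mk⇔) (λ e → to e , from e)
      ((incident? (x i) (y S) →-dec i ∈? S) ×-dec (i ∈? S →-dec incident? (x i) (y S)))

-- The 3-graphs HP(k)

HP-shatters : Shatters (GraphOf (HP 1)) 1
HP-shatters = x , y , from-yes (shattered? {HP 1} x y)
  where
  x : Fin 1 → V (HP 1) ⊎ Pair (V (HP 1))
  x _ = inj₁ (a , 0F)

  y : Subset 1 → V (HP 1) ⊎ Pair (V (HP 1))
  y (inside  ∷ []) = inj₂ (((b , 0F) , (c , 0F)) , λ ())
  -- Two vertices are never incident, so a vertex serves for the empty set.
  y (outside ∷ []) = inj₁ (a , 0F)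

HP-¬shatters : ∀ k → ¬ Shatters (GraphOf (HP k)) 2
HP-¬shatters k sh
  with x , y , s ← Shatters⇒sums ℕₚ.+-isCommutativeSemigroup ⟦_⟧ (k + 2 ≤_) _ _ _ _ sh
  = [ crossed 0F 1F (λ ()) , crossed 1F 0F (λ ()) ]′ (ℕₚ.≤-total (x 0F) (x 1F))
  where
  -- The partner of `⁅ i ⁆` lifts `x i` to the threshold, hence also the larger `x j`, which forces
  -- `j` into `⁅ i ⁆`.
  crossed : ∀ i j → i ≢ j → x i ≤ x j → ⊥
  crossed i j i≢j xi≤xj =
    i≢j (sym (to x∈⁅y⁆⇔x≡y (to (s j ⁅ i ⁆ (i , x∈⁅x⁆ i))
      (ℕₚ.≤-trans (from (s i ⁅ i ⁆ (i , x∈⁅x⁆ i)) (x∈⁅x⁆ i)) (ℕₚ.+-monoˡ-≤ _ xi≤xj)))))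

-- Binary branching in the tree of vectors

module Branching {C : Set} (_≟_ : DecidableEquality C)
                 (σ : C → C) (σσx≢x : ∀ x → σ (σ x) ≢ x) where

  Adjacent : C → C → Set
  Adjacent x y = x ≡ σ y ⊎ y ≡ σ x

  -- At the first coordinate where x and z differ, x takes the value σ of z.
  Branch : ∀ {n} → Vec C n → Vec C n → Set
  Branch {zero}  x z = ⊥
  Branch {suc n} x z = head x ≡ σ (head z) ⊎ (head x ≡ head z × Branch (tail x) (tail z))

  -- i = j is allowed, so that z i i cuts out a single point.
  Separates : ∀ {k n} → (Fin k → Fin k → Vec C n) → (Fin k → Vec C n) → Set
  Separates z x = ∀ i j l → Branch (x l) (z i j) ⇔ (l ≡ i ⊎ l ≡ j)

  avoid-two : ∀ {k} (i j : Fin (3 + k)) → ∃[ l ] ¬ (l ≡ i ⊎ l ≡ j)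
  avoid-two zero          zero          = 1F , λ { (inj₁ ()) ; (inj₂ ()) }
  avoid-two zero          (suc zero)    = 2F , λ { (inj₁ ()) ; (inj₂ ()) }
  avoid-two zero          (suc (suc _)) = 1F , λ { (inj₁ ()) ; (inj₂ ()) }
  avoid-two (suc zero)    zero          = 2F , λ { (inj₁ ()) ; (inj₂ ()) }
  avoid-two (suc (suc _)) zero          = 1F , λ { (inj₁ ()) ; (inj₂ ()) }
  avoid-two (suc _)       (suc _)       = 0F , λ { (inj₁ ()) ; (inj₂ ()) }

  module _ {k n} (z : Fin k → Fin k → Vec C (suc n)) (x : Fin k → Vec C (suc n))
           (sep : Separates z x) where

    private
      r : Fin k → C
      r = head ∘ x

      ζ : Fin k → Fin k → C
      ζ i j = head (z i j)

      head-choice : ∀ i j {l} → l ≡ i ⊎ l ≡ j → r l ≡ σ (ζ i j) ⊎ r l ≡ ζ i j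
      head-choice i j l∈ = map₂ proj₁ (from (sep i j _) l∈)

      selected : ∀ i j {l} → r l ≡ σ (ζ i j) → l ≡ i ⊎ l ≡ j
      selected i j = to (sep i j _) ∘ inj₁

    -- Both heads lie in {ζ, σ ζ} for the head ζ of `z i j`.
    heads-adjacent : ∀ i j → r i ≢ r j → Adjacent (r i) (r j)
    heads-adjacent i j ri≢rj with head-choice i j (inj₁ refl) | head-choice i j (inj₂ refl)
    ... | inj₁ p | inj₁ q = contradiction (trans p (sym q)) ri≢rj
    ... | inj₁ p | inj₂ q = inj₁ (trans p (cong σ (sym q)))
    ... | inj₂ p | inj₁ q = inj₂ (trans q (cong σ (sym p)))
    ... | inj₂ p | inj₂ q = contradiction (trans p (sym q)) ri≢rj

    -- Suppose `r j` differs from the repeated value. If `r j` is `σ (r i)`, then `z i i`, in order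
    -- to select `i`, also selects `i′` or `j`. If `r i` is `σ (r j)`, then `z i j` must have `r i`
    -- as the σ of its head, and so also selects `i′`.
    repeated-head⇒constant : ∀ {i i′} → i ≢ i′ → r i ≡ r i′ → ∀ j → r i ≡ r j
    repeated-head⇒constant {i} {i′} i≢i′ ri≡ri′ j with r i ≟ r j
    ... | yes ri≡rj = ri≡rj
    ... | no  ri≢rj with heads-adjacent i j ri≢rj
    ...   | inj₂ rj≡σri with head-choice i i (inj₁ refl)
    ...     | inj₁ p = contradiction (sym (reduce (selected i i (trans (sym ri≡ri′) p)))) i≢i′
    ...     | inj₂ p = contradiction
      (cong r (sym (reduce (selected i i (trans rj≡σri (cong σ p)))))) ri≢rj
    repeated-head⇒constant {i} {i′} i≢i′ ri≡ri′ j
        | no ri≢rj | inj₁ ri≡σrj with head-choice i j (inj₁ refl)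
    ...     | inj₁ p = ⊥-elim ([ i≢i′ ∘ sym , (λ i′≡j → ri≢rj (trans ri≡ri′ (cong r i′≡j))) ]′
      (selected i j (trans (sym ri≡ri′) p)))
    ...     | inj₂ p with head-choice i j (inj₂ refl)
    -- Here `r j` is `σ (r i)` while `r i` is `σ (r j)`, a 2-cycle of σ.
    ...       | inj₁ q = contradiction (sym (trans q (cong σ (trans (sym p) ri≡σrj)))) (σσx≢x (r j))
    ...       | inj₂ q = contradiction (trans p (sym q)) ri≢rj

    -- If the constant head were σ of the head of `z i j`, every point would be selected, including
    -- the one that `avoid` provides. So it equals the head of `z i j`, and all branching happens in
    -- the tails.
    Separates-tail : (∀ i j → r i ≡ r j) → (∀ i j → ∃[ l ] ¬ (l ≡ i ⊎ l ≡ j)) →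
                     Separates (λ i j → tail (z i j)) (tail ∘ x)
    Separates-tail const avoid i j l = mk⇔
      (λ t → to (sep i j l) (inj₂ (rl≡ζ , t)))
      (λ l∈ → [ (λ p → contradiction p rl≢σζ) , proj₂ ]′ (from (sep i j l) l∈))
      where
      rl≢σζ : r l ≢ σ (ζ i j)
      rl≢σζ p with o , o∉ ← avoid i j = o∉ (selected i j (trans (const o l) p))

      rl≡ζ : r l ≡ ζ i j
      rl≡ζ with head-choice i j (inj₁ refl)
      ... | inj₁ p = contradiction (trans (const l i) p) rl≢σζ
      ... | inj₂ p = trans (const l i) p

  -- Induction on the length. A constant first coordinate is dropped; otherwise the heads are
  -- distinct and pairwise adjacent, against `spread`. At length 0 nothing branches, yet `z 0F 0F`
  -- must select `0F`.
  ¬Separates : ∀ {k} →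
    (∀ (r : Fin (3 + k) → C) → Injective _≡_ _≡_ r → ¬ (∀ i j → i ≢ j → Adjacent (r i) (r j))) →
    ∀ {n} (z : Fin (3 + k) → Fin (3 + k) → Vec C n) x → ¬ Separates z x
  ¬Separates spread {zero}  z x sep = from (sep 0F 0F 0F) (inj₁ refl)
  ¬Separates spread {suc n} z x sep with Finₚ.all? (λ i → head (x 0F) ≟ head (x i))
  ... | yes const = ¬Separates spread _ _
    (Separates-tail z x sep (λ i j → trans (sym (const i)) (const j)) avoid-two)
  ... | no ¬const = spread (head ∘ x) injective λ i j i≢j →
    heads-adjacent z x sep i j (i≢j ∘ injective)
    where
    injective : Injective _≡_ _≡_ (head ∘ x)
    injective {i} {j} ri≡rj with i Finₚ.≟ j
    ... | yes i≡j = i≡j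
    ... | no  i≢j = contradiction
      (λ l → trans (sym (constant 0F)) (constant l)) ¬const
      where constant = repeated-head⇒constant z x sep i≢j ri≡rj

-- Addition modulo p

module Cyclic (p : ℕ) .⦃ _ : NonZero p ⦄ where

  open ≡-Reasoning

  _+ₚ_ : Op₂ (Fin p)
  x +ₚ y = (toℕ x + toℕ y) mod p

  -- The outer `mod` matters at 0, where `p ∸ 0` is `p`.
  -ₚ_ : Fin p → Fin p
  -ₚ x = (p ∸ toℕ x) mod p

  toℕ-mod : ∀ m → toℕ (m mod p) ≡ m % p
  toℕ-mod m = Finₚ.toℕ-fromℕ< (m%n<n m p)

  mod-toℕ : ∀ x → toℕ x mod p ≡ x
  mod-toℕ x = Finₚ.toℕ-injective (trans (toℕ-mod (toℕ x)) (m<n⇒m%n≡m (Finₚ.toℕ<n x)))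

  -- Since every element is a residue by `mod-toℕ`, this reduces associativity, identity and
  -- inverses to facts about ℕ.
  mod-+ : ∀ m n → (m mod p) +ₚ (n mod p) ≡ (m + n) mod p
  mod-+ m n = Finₚ.toℕ-injective (begin
    toℕ ((m mod p) +ₚ (n mod p))            ≡⟨ toℕ-mod _ ⟩
    (toℕ (m mod p) + toℕ (n mod p)) % p     ≡⟨ cong₂ (λ i j → (i + j) % p) (toℕ-mod m) (toℕ-mod n) ⟩
    (m % p + n % p) % p                     ≡⟨ %-distribˡ-+ m n p ⟨
    (m + n) % p                             ≡⟨ toℕ-mod _ ⟨
    toℕ ((m + n) mod p)                     ∎)

  +ₚ-assoc : ∀ x y z → (x +ₚ y) +ₚ z ≡ x +ₚ (y +ₚ z)
  +ₚ-assoc x y z = begin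
    (x +ₚ y) +ₚ z                     ≡⟨ cong ((x +ₚ y) +ₚ_) (mod-toℕ z) ⟨
    (x +ₚ y) +ₚ (toℕ z mod p)         ≡⟨ mod-+ _ _ ⟩
    (toℕ x + toℕ y + toℕ z) mod p     ≡⟨ cong (_mod p) (ℕₚ.+-assoc (toℕ x) _ _) ⟩
    (toℕ x + (toℕ y + toℕ z)) mod p   ≡⟨ mod-+ _ _ ⟨
    (toℕ x mod p) +ₚ (y +ₚ z)         ≡⟨ cong (_+ₚ (y +ₚ z)) (mod-toℕ x) ⟩
    x +ₚ (y +ₚ z)                     ∎

  +ₚ-comm : ∀ x y → x +ₚ y ≡ y +ₚ x
  +ₚ-comm x y = cong (_mod p) (ℕₚ.+-comm (toℕ x) (toℕ y))

  +ₚ-identityˡ : ∀ x → (0 mod p) +ₚ x ≡ x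
  +ₚ-identityˡ x = begin
    (0 mod p) +ₚ x             ≡⟨ cong ((0 mod p) +ₚ_) (mod-toℕ x) ⟨
    (0 mod p) +ₚ (toℕ x mod p) ≡⟨ mod-+ 0 (toℕ x) ⟩
    toℕ x mod p                ≡⟨ mod-toℕ x ⟩
    x                          ∎

  +ₚ-inverseˡ : ∀ x → (-ₚ x) +ₚ x ≡ 0 mod p
  +ₚ-inverseˡ x = begin
    (-ₚ x) +ₚ x                 ≡⟨ cong ((-ₚ x) +ₚ_) (mod-toℕ x) ⟨
    (-ₚ x) +ₚ (toℕ x mod p)     ≡⟨ mod-+ _ _ ⟩
    (p ∸ toℕ x + toℕ x) mod p   ≡⟨ cong (_mod p) (ℕₚ.m∸n+n≡m (Finₚ.toℕ≤n x)) ⟩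
    p mod p                     ≡⟨ Finₚ.toℕ-injective (begin
      toℕ (p mod p)   ≡⟨ toℕ-mod p ⟩
      p % p           ≡⟨ n%n≡0 p ⟩
      0               ≡⟨ m*n%n≡0 0 p ⟨
      0 % p           ≡⟨ toℕ-mod 0 ⟨
      toℕ (0 mod p)   ∎) ⟩
    0 mod p                     ∎

  +ₚ-isAbelianGroup : IsAbelianGroup _≡_ _+ₚ_ (0 mod p) -ₚ_
  +ₚ-isAbelianGroup = record
    { isGroup = record
      { isMonoid = record
        { isSemigroup = record { isMagma = isMagma _+ₚ_ ; assoc = +ₚ-assoc }
        ; identity    = comm∧idˡ⇒id +ₚ-comm +ₚ-identityˡ
        }
      ; inverse = comm∧invˡ⇒inv +ₚ-comm +ₚ-inverseˡ
      ; ⁻¹-cong = cong -ₚ_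
      }
    ; comm = +ₚ-comm
    }

  +ₚ-abelianGroup : AbelianGroup 0ℓ 0ℓ
  +ₚ-abelianGroup = record { isAbelianGroup = +ₚ-isAbelianGroup }

  ⊕-isCommutativeSemigroup : ∀ n → IsCommutativeSemigroup _≡_ (_⊕_ {p} {n})
  ⊕-isCommutativeSemigroup n = record
    { isSemigroup = record { isMagma = isMagma _⊕_ ; assoc = Vecₚ.zipWith-assoc +ₚ-assoc }
    ; comm        = Vecₚ.zipWith-comm +ₚ-comm
    }

-- The leading 1 stands at the front or, behind a 0, in the tail; this is the recursion of `Branch`.
A-∷ : ∀ {p n h} {t : 𝔽^ p n} → A p (suc n) (h ∷ t) ⇔ (toℕ h ≡ 1 ⊎ (toℕ h ≡ 0 × A p n t))
A-∷ = mk⇔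
  (λ { (zero  , e , _)   → inj₁ e
     ; (suc i , e , low) → inj₂ (low zero (s≤s z≤n) , i , e , λ j j<i → low (suc j) (s≤s j<i)) })
  (λ { (inj₁ e)                 → zero , e , λ _ ()
     ; (inj₂ (e₀ , i , e , low)) → suc i , e , λ { zero _ → e₀ ; (suc j) (s≤s j<i) → low j j<i } })

-- The 3-graphs GS_p(n)

module GreenSanders (m : ℕ) where

  private
    p : ℕ
    p = 3 + m

  open Cyclic p
  open AbelianGroup +ₚ-abelianGroup using (group; inverseˡ)
  open Groupₚ group using (∙-cancelˡ; x≈z//y; identityˡ-unique; inverseˡ-unique; //-rightDividesˡ)

  σ : Fin p → Fin p
  σ = 1F +ₚ_

  σ-injective : Injective _≡_ _≡_ σ
  σ-injective = ∙-cancelˡ 1F _ _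

  -- Applying σ twice adds 2, which is nonzero because the modulus is at least 3.
  σσx≢x : ∀ x → σ (σ x) ≢ x
  σσx≢x x e with () ← identityˡ-unique (1F +ₚ 1F) x (trans (+ₚ-assoc 1F 1F x) e)

  open Branching Finₚ._≟_ σ σσx≢x public

  A⊕⇔Branch : ∀ {n} (x y : 𝔽^ p n) → A p n (x ⊕ y) ⇔ Branch x (map -ₚ_ y)
  A⊕⇔Branch []       []       = mk⇔ (λ ()) (λ ())
  A⊕⇔Branch (x ∷ xs) (y ∷ ys) = (one ⊎-⇔ (nought ×-⇔ A⊕⇔Branch xs ys)) ⇔-∘ A-∷
    where
    one : toℕ (x +ₚ y) ≡ 1 ⇔ x ≡ σ (-ₚ y)
    one = mk⇔
      (λ e → x≈z//y x y 1F (Finₚ.toℕ-injective e))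
      (λ e → cong toℕ (trans (cong (_+ₚ y) e) (//-rightDividesˡ y 1F)))

    nought : toℕ (x +ₚ y) ≡ 0 ⇔ x ≡ -ₚ y
    nought = mk⇔
      (λ e → inverseˡ-unique x y (Finₚ.toℕ-injective e))
      (λ e → cong toℕ (trans (cong (_+ₚ y) e) (inverseˡ y)))

  -- The sets `⁅ i ⁆ ∪ ⁅ j ⁆` of a shattered family, with their partners negated, give separating
  -- vectors.
  GS-¬shatters : ∀ {k} →
    (∀ (r : Fin (3 + k) → Fin p) → Injective _≡_ _≡_ r → ¬ (∀ i j → i ≢ j → Adjacent (r i) (r j))) →
    ∀ n → ¬ Shatters (GraphOf (GS p n)) (3 + k)
  GS-¬shatters {k} spread n sh
    with x , y , s ← Shatters⇒sums (⊕-isCommutativeSemigroup n) id (A p n) _ _ _ _ sh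
    = ¬Separates spread (λ i j → map -ₚ_ (y (⁅ i ⁆ ∪ ⁅ j ⁆))) x λ i j l →
      (((x∈⁅y⁆⇔x≡y ⊎-⇔ x∈⁅y⁆⇔x≡y) ⇔-∘ ∪⇔⊎)
        ⇔-∘ s l (⁅ i ⁆ ∪ ⁅ j ⁆) (i , x∈p∪q⁺ (inj₁ (x∈⁅x⁆ i))))
      ⇔-∘ ⇔-sym (A⊕⇔Branch (x l) (y (⁅ i ⁆ ∪ ⁅ j ⁆)))

-- Bounds for p = 3 and for p ≥ 4

GS₃-¬shatters : ∀ n → ¬ Shatters (GraphOf (GS 3 n)) 4
-- Pigeonhole: four points cannot have distinct heads in `Fin 3`.
GS₃-¬shatters = GS-¬shatters λ r r-inj _ → ℕₚ.1+n≰n (Finₚ.injective⇒≤ r-inj)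
  where open GreenSanders 0

module _ (m : ℕ) where

  open GreenSanders (suc m)
  open Cyclic (4 + m)
  open AbelianGroup +ₚ-abelianGroup using (group)

  σσσx≢x : ∀ x → σ (σ (σ x)) ≢ x
  σσσx≢x x e with () ← Groupₚ.identityˡ-unique group ((1F +ₚ 1F) +ₚ 1F) x
    (trans (+ₚ-assoc (1F +ₚ 1F) 1F x) (trans (+ₚ-assoc 1F 1F (1F +ₚ x)) e))

  -- Orient each adjacency along σ. A cyclic triangle gives a fixed point of σ³; in any other, two
  -- arrows share a source or a target, and their other ends coincide.
  no-triangle : ∀ {x y z} → x ≢ y → y ≢ z → x ≢ z →
                Adjacent x y → Adjacent y z → ¬ Adjacent x z
  no-triangle _   y≢z _   (inj₁ p) (inj₁ q) (inj₁ r) = y≢z (σ-injective (trans (sym p) r))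
  no-triangle _   _   _   (inj₁ p) (inj₁ q) (inj₂ r) =
    σσσx≢x _ (sym (trans p (cong σ (trans q (cong σ r)))))
  no-triangle _   _   x≢z (inj₁ p) (inj₂ q) _        = x≢z (trans p (sym q))
  no-triangle _   _   x≢z (inj₂ p) (inj₁ q) _        = x≢z (σ-injective (trans (sym p) q))
  no-triangle _   _   _   (inj₂ p) (inj₂ q) (inj₁ r) =
    σσσx≢x _ (sym (trans r (cong σ (trans q (cong σ p)))))
  no-triangle x≢y _   _   (inj₂ p) (inj₂ q) (inj₂ r) = x≢y (σ-injective (trans (sym r) q))

  GS-¬shatters₃ : ∀ n → ¬ Shatters (GraphOf (GS (4 + m) n)) 3
  GS-¬shatters₃ = GS-¬shatters λ r r-inj adj →
    no-triangle ((λ ()) ∘ r-inj {0F} {1F}) ((λ ()) ∘ r-inj {1F} {2F}) ((λ ()) ∘ r-inj {0F} {2F})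
      (adj 0F 1F λ ()) (adj 1F 2F λ ()) (adj 0F 2F λ ())

  GS-shatters₂ : Shatters (GraphOf (GS (4 + m) 2)) 2
  GS-shatters₂ = x , y , from-yes (shattered? {H} x y)
    where
    H = GS (4 + m) 2

    -- The sum is (i,0) + v. For the full set v = (0,1) gives (0,1) and (1,1); for the empty set v =
    -- (2,0) gives first coordinates 2 and 3, neither 0 nor 1 modulo 4 + m.
    x : Fin 2 → V H ⊎ Pair (V H)
    x i = inj₁ (a , inject≤ i (s≤s (s≤s z≤n)) ∷ 0F ∷ [])

    pair : 𝔽^ (4 + m) 2 → V H ⊎ Pair (V H)
    pair v = inj₂ (((b , v) , (c , 0F ∷ 0F ∷ [])) , λ ())

    y : Subset 2 → V H ⊎ Pair (V H)
    y (inside  ∷ inside  ∷ []) = pair (0F ∷ 1F ∷ [])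
    y (inside  ∷ outside ∷ []) = pair (1F ∷ 0F ∷ [])
    y (outside ∷ inside  ∷ []) = pair (0F ∷ 0F ∷ [])
    y (outside ∷ outside ∷ []) = pair (2F ∷ 0F ∷ [])

GS₃-shatters : Shatters (GraphOf (GS 3 3)) 3
GS₃-shatters = x , y , from-yes (shattered? {H} x y)
  where
  H = GS 3 3

  -- The sum is (0,i,0) + v. A first coordinate 1 or 2 of v accepts or rejects all points at once.
  -- Otherwise the second coordinate of the sum runs through all residues: 1 is accepted, 2
  -- rejected, and 0 accepted exactly when v ends in 1.
  x : Fin 3 → V H ⊎ Pair (V H)
  x i = inj₁ (a , 0F ∷ i ∷ 0F ∷ [])

  pair : 𝔽^ 3 3 → V H ⊎ Pair (V H)
  pair v = inj₂ (((b , v) , (c , 0F ∷ 0F ∷ 0F ∷ [])) , λ ())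

  y : Subset 3 → V H ⊎ Pair (V H)
  y (inside  ∷ inside  ∷ inside  ∷ []) = pair (1F ∷ 0F ∷ 0F ∷ [])
  y (inside  ∷ inside  ∷ outside ∷ []) = pair (0F ∷ 0F ∷ 1F ∷ [])
  y (inside  ∷ outside ∷ inside  ∷ []) = pair (0F ∷ 1F ∷ 1F ∷ [])
  y (outside ∷ inside  ∷ inside  ∷ []) = pair (0F ∷ 2F ∷ 1F ∷ [])
  y (inside  ∷ outside ∷ outside ∷ []) = pair (0F ∷ 1F ∷ 0F ∷ [])
  y (outside ∷ inside  ∷ outside ∷ []) = pair (0F ∷ 0F ∷ 0F ∷ [])
  y (outside ∷ outside ∷ inside  ∷ []) = pair (0F ∷ 2F ∷ 0F ∷ [])
  y (outside ∷ outside ∷ outside ∷ []) = pair (2F ∷ 0F ∷ 0F ∷ [])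

-- The VC-dimensions of the two properties

VC-𝓗GS : ∀ p .⦃ _ : NonZero p ⦄ → 3 ≤ p → ∃[ d ] (VCproperty (𝓗GS p) d × d ≤ 3)
VC-𝓗GS 3 _ =
  3 , VCproperty-closure (GS 3) GS₃-¬shatters (s≤s z≤n) GS₃-shatters , ℕₚ.≤-refl
VC-𝓗GS (suc (suc (suc (suc m)))) _ =
  2 , VCproperty-closure (GS (4 + m)) (GS-¬shatters₃ m) (s≤s z≤n) (GS-shatters₂ m) , ℕₚ.n≤1+n 2
VC-𝓗GS 1 (s≤s ())
VC-𝓗GS 2 (s≤s (s≤s ()))

proposition2p59 : VCproperty 𝓗HP 1 ×
    (∀ (p : ℕ) .⦃ _ : NonZero p ⦄ → Prime p → 3 ≤ p →
    ∃[ d ] (VCproperty (𝓗GS p) d × d ≤ 3))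
proposition2p59 =
  VCproperty-closure HP HP-¬shatters (s≤s z≤n) HP-shatters , λ p _ → VC-𝓗GS p
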